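{- Let $A\subseteq\omega$ be an infinite c.e. set, let $\theta$ be a quasi-Gödel numbering of $\mathcal S^{(1)}_A$ and let $\varphi$ be a Gödel numbering of $\mathcal P^{(1)}$. Put $W^A_i=\mathrm{range}(\theta_i)$ and $W_i=\mathrm{dom}(\varphi_i)$ for $i\in\omega$. Then the numberings $W^A$ and $W$ of the c.e. subsets of $\omega$ are computably isomorphic, i.e. there is a computable bijection $g:\omega\to\omega$ with $W^A_i=W_{g(i)}$ for all $i\in\omega$.
   Context: $\omega$ is the set of natural numbers; $\mathcal P^{(n)}$ and $\mathcal R^{(n)}$ are the sets of $n$-ary partial, respectively total, computable functions on $\omega$. $\langle\cdot,\cdot\rangle:\omega^2\to\omega$ is a computable bijection with $\langle x,y\rangle\ge x,y$. $\mathrm{Anf}^{(1)}_A$ is the set of partial functions from $\omega$ to $\omega$ whose domain is either empty or equal to $\{0,\dots,a-1\}$ for some $a\in A$, and $\mathcal S^{(1)}_A=\mathcal R^{(1)}\cup\mathrm{Anf}^{(1)}_A$. The extended graph of a unary partial function $q$ is $\{\langle y,0\rangle:y\in\omega\}\cup\{\langle x,q(x)+1\rangle:x\in\mathrm{dom}(q)\}$; that of a binary partial function $q$ is $\{\langle\langle y,y'\rangle,0\rangle:y,y'\in\omega\}\cup\{\langle\langle x,x'\rangle,q(x,x')+1\rangle:(x,x')\in\mathrm{dom}(q)\}$. A numbering of a set $X$ is a surjection $\omega\to X$. A numbering $\theta$ of $\mathcal S^{(1)}_A$ is a quasi-Gödel numbering if: (QGN I) the extended graph of $(i,x)\mapsto\theta_i(x)$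 is the range of a function in $\mathcal R^{(1)}$; and (QGN II) for every $k\in\mathcal R^{(2)}$ there is $v\in\mathcal R^{(1)}$ such that for all $i\in\omega$, $r\in\mathcal S^{(1)}_A$: if $\{k(i,t):t\in\omega\}$ is the extended graph of $r$, then $r=\theta_{v(i)}$. A Gödel numbering of $\mathcal P^{(1)}$ is a numbering $\varphi$ with partial computable universal function $(i,x)\mapsto\varphi_i(x)$ such that for every $g\in\mathcal P^{(2)}$ there is $s\in\mathcal R^{(1)}$ with $\varphi_{s(i)}(x)=g(i,x)$ for all $i,x$. -}

module Defs where

open import Data.Fin.Base using (Fin)
open import Data.Nat.Base using (ℕ; suc; _≤_; _<_)
open import Data.Nat.Properties using (<-cmp; 0≢1+n)
open import Data.Product.Base using (_×_; _,_; ∃-syntax; uncurry)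
open import Data.Sum.Base using (_⊎_)
open import Data.Vec.Base using (Vec; []; _∷_; [_]; lookup)
open import Data.Vec.N-ary using (N-ary; _$ⁿ_)
open import Data.Vec.Relation.Binary.Pointwise.Extensional using (ext; Pointwise-≡⇒≡)
open import Function.Bundles using (_⇔_)
open import Function.Definitions using (Bijective)
open import Level using (0ℓ)
open import Relation.Binary.Definitions using (tri<; tri≈; tri>)
open import Relation.Binary.PropositionalEquality using (_≡_; refl; sym; trans)
open import Relation.Nullary.Negation using (contradiction)
open import Relation.Unary using (Pred; _∈_; _∪_; _≐_; Empty)

private
  variable
    m n : ℕ

-- A partial function ω^n → ω is given by its graph.

record Partial (n : ℕ) : Set₁ where
  field
    Graph      : Vec ℕ n → ℕ → Set
    functional : ∀ {xs y z} → Graph xs y → Graph xs z → y ≡ z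

open Partial public

infix 4 _≈_

_≈_ : Partial n → Partial n → Set
p ≈ q = ∀ xs y → Graph p xs y ⇔ Graph q xs y

Total : Partial n → Set
Total q = ∀ xs → ∃[ y ] Graph q xs y

Dom : Partial 1 → Pred ℕ 0ℓ
Dom q x = ∃[ y ] Graph q [ x ] y

Range : Partial n → Pred ℕ 0ℓ
Range q y = ∃[ xs ] Graph q xs y

total : ∀ n → N-ary n ℕ ℕ → Partial n
total n f = record
  { Graph      = λ xs y → (f $ⁿ xs) ≡ y
  ; functional = λ p q → trans (sym p) q
  }

-- Kleene's μ-recursive functions.  Primitive recursion and minimisation
-- both act on the first argument.

data Code : ℕ → Set where
  zer  : Code 0
  succ : Code 1
  proj : Fin n → Code n
  comp : Code m → Vec (Code n) m → Code n
  prec : Code n → Code (suc (suc n)) → Code (suc n)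
  mu   : Code (suc n) → Code n

infix 4 _[_]⇓_

data _[_]⇓_ : Code n → Vec ℕ n → ℕ → Set where
  zer⇓   : zer [ [] ]⇓ 0
  succ⇓  : ∀ {x} → succ [ x ∷ [] ]⇓ suc x
  proj⇓  : ∀ {xs : Vec ℕ n} {i} → proj i [ xs ]⇓ lookup xs i
  comp⇓  : ∀ {f : Code m} {gs : Vec (Code n) m} {xs ys y} →
           (∀ i → lookup gs i [ xs ]⇓ lookup ys i) →
           f [ ys ]⇓ y → comp f gs [ xs ]⇓ y
  prec0⇓ : ∀ {f : Code n} {g xs y} →
           f [ xs ]⇓ y → prec f g [ 0 ∷ xs ]⇓ y
  precS⇓ : ∀ {f : Code n} {g xs k y z} →
           prec f g [ k ∷ xs ]⇓ y → g [ k ∷ y ∷ xs ]⇓ z →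
           prec f g [ suc k ∷ xs ]⇓ z
  mu⇓    : ∀ {f : Code (suc n)} {xs y} →
           (∀ k → k < y → ∃[ w ] f [ k ∷ xs ]⇓ suc w) →
           f [ y ∷ xs ]⇓ 0 → mu f [ xs ]⇓ y

⇓-functional : ∀ {c : Code n} {xs y z} → c [ xs ]⇓ y → c [ xs ]⇓ z → y ≡ z
⇓-functional zer⇓ zer⇓ = refl
⇓-functional succ⇓ succ⇓ = refl
⇓-functional proj⇓ proj⇓ = refl
⇓-functional (comp⇓ {ys = ys} gs f) (comp⇓ {ys = ys′} gs′ f′)
  with refl ← Pointwise-≡⇒≡ {xs = ys} {ys = ys′} (ext λ i → ⇓-functional (gs i) (gs′ i))
  = ⇓-functional f f′
⇓-functional (prec0⇓ f) (prec0⇓ f′) = ⇓-functional f f′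
⇓-functional (precS⇓ r g) (precS⇓ r′ g′)
  with refl ← ⇓-functional r r′ = ⇓-functional g g′
⇓-functional {y = y} {z} (mu⇓ below f) (mu⇓ below′ f′) with <-cmp y z
... | tri≈ _ y≡z _ = y≡z
... | tri< y<z _ _ with (w , g) ← below′ y y<z = contradiction (⇓-functional f g) 0≢1+n
... | tri> _ _ z<y with (w , g) ← below z z<y = contradiction (⇓-functional f′ g) 0≢1+n

⟦_⟧ : Code n → Partial n
⟦ c ⟧ = record { Graph = c [_]⇓_ ; functional = ⇓-functional }

-- The n-ary partial, respectively total, computable functions.

𝓟 : ∀ n → Pred (Partial n) 0ℓ
𝓟 n q = ∃[ c ] q ≈ ⟦ c ⟧

𝓡 : ∀ n → Pred (Partial n) 0ℓ
𝓡 n q = q ∈ 𝓟 n × Total q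

Computable : ∀ n → N-ary n ℕ ℕ → Set
Computable n f = total n f ∈ 𝓡 n

CE : Pred ℕ 0ℓ → Set₁
CE X = ∃[ q ] q ∈ 𝓟 1 × X ≐ Dom q

record Pairing : Set where
  field
    ⟨_,_⟩      : ℕ → ℕ → ℕ
    computable : Computable 2 ⟨_,_⟩
    bijective  : Bijective _≡_ _≡_ (uncurry ⟨_,_⟩)
    x≤⟨x,y⟩    : ∀ x y → x ≤ ⟨ x , y ⟩
    y≤⟨x,y⟩    : ∀ x y → y ≤ ⟨ x , y ⟩

Anf : Pred ℕ 0ℓ → Pred (Partial 1) 0ℓ
Anf A q = Empty (Dom q) ⊎ (∃[ a ] a ∈ A × Dom q ≐ (_< a))

𝓢 : Pred ℕ 0ℓ → Pred (Partial 1) 0ℓ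
𝓢 A = 𝓡 1 ∪ Anf A

module _ (P : Pairing) where
  open Pairing P

  ExtGraph₁ : Partial 1 → Pred ℕ 0ℓ
  ExtGraph₁ q z =
    (∃[ y ] z ≡ ⟨ y , 0 ⟩) ⊎
    (∃[ x ] ∃[ y ] Graph q [ x ] y × z ≡ ⟨ x , suc y ⟩)

  ExtGraph₂ : Partial 2 → Pred ℕ 0ℓ
  ExtGraph₂ q z =
    (∃[ y ] ∃[ y′ ] z ≡ ⟨ ⟨ y , y′ ⟩ , 0 ⟩) ⊎
    (∃[ x ] ∃[ x′ ] ∃[ y ] Graph q (x ∷ x′ ∷ []) y × z ≡ ⟨ ⟨ x , x′ ⟩ , suc y ⟩)

record IsNumberingOf (X : Pred (Partial 1) 0ℓ) (ν : ℕ → Partial 1) : Set₁ where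
  field
    into : ∀ i → ν i ∈ X
    onto : ∀ q → q ∈ X → ∃[ i ] ν i ≈ q

-- (i , x) ↦ νᵢ(x)

universal : (ℕ → Partial 1) → Partial 2
universal ν = record
  { Graph      = λ { (i ∷ x ∷ []) y → Graph (ν i) [ x ] y }
  ; functional = λ { {i ∷ x ∷ []} → functional (ν i) }
  }

record IsQuasiGödelNumbering (P : Pairing) (A : Pred ℕ 0ℓ)
                             (θ : ℕ → Partial 1) : Set₁ where
  field
    isNumbering : IsNumberingOf (𝓢 A) θ
    QGN-I       : ∃[ h ] Computable 1 h ×
                  ExtGraph₂ P (universal θ) ≐ Range (total 1 h)
    QGN-II      : ∀ k → Computable 2 k →
                  ∃[ v ] Computable 1 v ×
                  (∀ i r → r ∈ 𝓢 A →
                   Range (total 1 (k i)) ≐ ExtGraph₁ P r → r ≈ θ (v i))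

record IsGödelNumbering (φ : ℕ → Partial 1) : Set₁ where
  field
    isNumbering : IsNumberingOf (𝓟 1) φ
    computable  : universal φ ∈ 𝓟 2
    s-m-n       : ∀ g → g ∈ 𝓟 2 →
                  ∃[ s ] Computable 1 s ×
                  (∀ i x y → Graph (φ (s i)) [ x ] y ⇔ Graph g (i ∷ x ∷ []) y)

ComputablyIsomorphic : (ν μ : ℕ → Pred ℕ 0ℓ) → Set
ComputablyIsomorphic ν μ =
  ∃[ g ] Computable 1 g × Bijective _≡_ _≡_ g × (∀ i → ν i ≐ μ (g i))

{-# OPTIONS --safe #-}

-- Both numberings of the c.e. sets are reducible to each other by injections g with g x > x,
-- and such a pair of reductions yields a computable isomorphism (Schröder–Bernstein).
-- Injectivity comes from the recursion theorem for φ, which transfers to every numbering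
-- to which W reduces.  W reduces to W^A because 𝓢 A contains the empty function and all
-- total functions: θ (v i) lists W_i, or is empty if W_i is.  That case distinction is not
-- constructive; the infinite c.e. set A serves to turn the resulting ¬ ¬ (x ∈ W_i) into x ∈ W_i.

module Submission where

open import Defs
open import Data.Fin.Base using (Fin; zero; suc; toℕ; fromℕ<)
open import Data.Fin.Patterns using (0F; 1F; 2F; 3F)
open import Data.Fin.Properties using (toℕ-injective; fromℕ<-injective; injective⇒≤; toℕ<n)
open import Data.Nat.Base
  using (ℕ; zero; suc; pred; _+_; _∸_; _≤_; _<_; _⊔_; s≤s; z≤n; z<s; ≢-nonZero)
open import Data.Nat.Induction using (<-rec)
open import Data.Nat.InfinitelyOften using (Inf)
open import Data.Nat.Properties
open import Data.Product.Base using (_×_; _,_; ∃-syntax; proj₁; proj₂; map₂)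
open import Data.Sum.Base using (_⊎_; inj₁; inj₂; [_,_]′)
open import Data.Vec.Base using (Vec; []; _∷_; [_]; lookup; head; tail; tabulate)
open import Data.Vec.N-ary using (_$ⁿ_)
open import Data.Vec.Properties using (lookup∘tabulate)
open import Function.Base using (_∘_; id)
open import Function.Bundles using (_⇔_; mk⇔; Equivalence)
open import Function.Definitions using (Injective)
open import Level using (0ℓ)
open import Relation.Binary.Definitions using (tri<; tri≈; tri>)
open import Relation.Binary.PropositionalEquality
  using (_≡_; _≢_; refl; sym; trans; cong; cong₂; subst; _≗_)
open import Relation.Nullary.Decidable using (Dec; yes; no; map′; decidable-stable)
open import Relation.Nullary.Negation using (¬_; contradiction)
open import Relation.Unary using (Pred; _∈_; _≐_)

open Equivalence using (to; from)

private
  variable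
    m n : ℕ

-- For θ there is no s-m-n property: `QGN-II` yields a correct index only when the listed set is the
-- extended graph of a function in `𝓢 A`, so indices cannot be padded directly. Self-reference
-- therefore takes place in φ and is carried along a mere many-one reduction of W, which need not be
-- injective. Inflation is what makes Schröder-Bernstein effective: preimages are smaller than their
-- images, so every backward chain ends and a bounded search decides how. As computability is
-- defined by a big-step semantics, a step-indexed evaluator is needed to present c.e. sets as
-- projections of decidable relations.

least : {P : ℕ → Set} → (∀ k → Dec (P k)) → ∀ y → P y →
        ∃[ l ] P l × (∀ k → k < l → ¬ P k)
least {P} P? = <-rec _ λ y rec py → case-below y rec py (anyUpTo? P? y)
  where
  case-below : ∀ y → (∀ {k} → k < y → P k → ∃[ l ] P l × (∀ k → k < l → ¬ P k)) →
               P y → Dec (∃[ k ] k < y × P k) → ∃[ l ] P l × (∀ k → k < l → ¬ P k)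
  case-below y rec py (yes (k , k<y , pk)) = rec k<y pk
  case-below y rec py (no none) = y , py , λ k k<y pk → none (k , k<y , pk)

suc-pred-≢0 : ∀ {k} → k ≢ 0 → suc (pred k) ≡ k
suc-pred-≢0 ≢0 = suc-pred _ {{≢-nonZero ≢0}}

-- Total recursive functions

record Recursive (f : Vec ℕ n → ℕ) : Set where
  field
    code     : Code n
    computes : ∀ xs → code [ xs ]⇓ f xs

record RecursiveMap (F : Vec ℕ n → Vec ℕ m) : Set where
  field
    codes     : Vec (Code n) m
    computes* : ∀ xs i → lookup codes i [ xs ]⇓ lookup (F xs) i

open Recursive
open RecursiveMap

private
  variable
    f₁ f₂ f₃ : Vec ℕ n → ℕ
    F : Vec ℕ m → Vec ℕ n

fromComputable : ∀ {f} → Computable n f → Recursive (f $ⁿ_)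
fromComputable ((c , eq) , _) = record { code = c ; computes = λ xs → to (eq xs _) refl }

toComputable : ∀ {f} → Recursive (f $ⁿ_) → Computable n f
toComputable R =
  (code R , λ xs y → mk⇔ (λ { refl → computes R xs }) (⇓-functional (computes R xs))) ,
  λ xs → _ , refl

cast : f₁ ≗ f₂ → Recursive f₁ → Recursive f₂
cast f₁≗f₂ R = record
  { code = code R ; computes = λ xs → subst (code R [ xs ]⇓_) (f₁≗f₂ xs) (computes R xs) }

var : (i : Fin n) → Recursive (λ xs → lookup xs i)
var i = record { code = proj i ; computes = λ _ → proj⇓ }

infixr 9 _∘ᴿ_
infixr 5 _∷ᴿ_

_∘ᴿ_ : Recursive f₁ → RecursiveMap F → Recursive (f₁ ∘ F)
R ∘ᴿ S = record
  { code     = comp (code R) (codes S)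
  ; computes = λ xs → comp⇓ (computes* S xs) (computes R _)
  }

[]ᴿ : RecursiveMap {n} (λ _ → [])
[]ᴿ = record { codes = [] ; computes* = λ _ () }

_∷ᴿ_ : Recursive f₁ → RecursiveMap F → RecursiveMap (λ xs → f₁ xs ∷ F xs)
R ∷ᴿ S = record
  { codes     = code R ∷ codes S
  ; computes* = λ { xs zero → computes R xs ; xs (suc i) → computes* S xs i }
  }

idᴿ : RecursiveMap {n} id
idᴿ = record
  { codes     = tabulate proj
  ; computes* = λ xs i →
      subst (_[ xs ]⇓ lookup xs i) (sym (lookup∘tabulate proj i)) proj⇓
  }

-- Serves as weakening: under a recursion or a bounded quantifier the parameters sit behind freshly
-- bound variables.
tailᴿ : ∀ {F : Vec ℕ m → Vec ℕ (suc n)} → RecursiveMap F → RecursiveMap (tail ∘ F)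
tailᴿ {F = F} S = record { codes = tail (codes S) ; computes* = tail-computes }
  where
  tail-computes : ∀ xs i → lookup (tail (codes S)) i [ xs ]⇓ lookup (tail (F xs)) i
  tail-computes xs i with codes S | F xs | computes* S xs (suc i)
  ... | _ ∷ _ | _ ∷ _ | c⇓ = c⇓

zeroᴿ : Recursive {n} (λ _ → 0)
zeroᴿ = _∘ᴿ_ {f₁ = λ _ → 0} (record { code = zer ; computes = λ { [] → zer⇓ } }) []ᴿ

sucᴿ : Recursive f₁ → Recursive (suc ∘ f₁)
sucᴿ {f₁ = f₁} R = record
  { code     = comp succ (code R ∷ [])
  ; computes = λ xs → comp⇓ {ys = f₁ xs ∷ []} (λ { zero → computes R xs }) succ⇓
  }

constᴿ : ∀ k → Recursive {n} (λ _ → k)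
constᴿ zero    = zeroᴿ
constᴿ (suc k) = sucᴿ (constᴿ k)

app₁ : {f : ℕ → ℕ} → Recursive {1} (f $ⁿ_) → Recursive f₁ → Recursive (λ xs → f (f₁ xs))
app₁ R S = R ∘ᴿ (S ∷ᴿ []ᴿ)

app₂ : {f : ℕ → ℕ → ℕ} → Recursive {2} (f $ⁿ_) → Recursive f₁ → Recursive f₂ →
       Recursive (λ xs → f (f₁ xs) (f₂ xs))
app₂ R S T = R ∘ᴿ (S ∷ᴿ T ∷ᴿ []ᴿ)

primrec : ℕ → (ℕ → ℕ → ℕ) → ℕ → ℕ
primrec z s zero    = z
primrec z s (suc k) = s k (primrec z s k)

primrecᴿ : Recursive f₁ → Recursive f₂ → Recursive f₃ →
           Recursive (λ xs → primrec (f₁ xs) (λ k r → f₂ (k ∷ r ∷ xs)) (f₃ xs))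
primrecᴿ {f₁ = f₁} {f₂ = f₂} R S T =
  record { code = prec (code R) (code S) ; computes = rec⇓ } ∘ᴿ (T ∷ᴿ idᴿ)
  where
  rec⇓ : ∀ xs → prec (code R) (code S) [ xs ]⇓
         primrec (f₁ (tail xs)) (λ k r → f₂ (k ∷ r ∷ tail xs)) (head xs)
  rec⇓ (zero  ∷ xs) = prec0⇓ (computes R xs)
  rec⇓ (suc k ∷ xs) = precS⇓ (rec⇓ (k ∷ xs)) (computes S _)

predᴿ : Recursive f₁ → Recursive (pred ∘ f₁)
predᴿ {f₁ = f₁} R =
  cast (λ xs → pred-primrec (f₁ xs)) (primrecᴿ zeroᴿ (var 0F) R)
  where
  pred-primrec : ∀ k → primrec 0 (λ k _ → k) k ≡ pred k
  pred-primrec zero    = refl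
  pred-primrec (suc k) = refl

∸ᴿ : Recursive f₁ → Recursive f₂ → Recursive (λ xs → f₁ xs ∸ f₂ xs)
∸ᴿ {f₁ = f₁} {f₂ = f₂} R S =
  cast (λ xs → ∸-primrec (f₁ xs) (f₂ xs)) (primrecᴿ R (predᴿ (var 1F)) S)
  where
  ∸-primrec : ∀ a b → primrec a (λ _ r → pred r) b ≡ a ∸ b
  ∸-primrec a zero    = refl
  ∸-primrec a (suc b) = trans (cong pred (∸-primrec a b)) (pred[m∸n]≡m∸[1+n] a b)

ifz : ℕ → ℕ → ℕ → ℕ
ifz zero    a b = a
ifz (suc _) a b = b

ifzᴿ : Recursive f₁ → Recursive f₂ → Recursive f₃ →
       Recursive (λ xs → ifz (f₁ xs) (f₂ xs) (f₃ xs))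
ifzᴿ {f₁ = f₁} {f₂ = f₂} {f₃ = f₃} R S T =
  cast (λ xs → ifz-primrec (f₁ xs) (f₂ xs) (f₃ xs))
       (primrecᴿ S (T ∘ᴿ tailᴿ (tailᴿ idᴿ)) R)
  where
  ifz-primrec : ∀ k a b → primrec a (λ _ _ → b) k ≡ ifz k a b
  ifz-primrec zero    a b = refl
  ifz-primrec (suc k) a b = refl

-- Decidable predicates; the characteristic function vanishes on the predicate.

record RecPred (P : Vec ℕ n → Set) : Set where
  field
    char      : Vec ℕ n → ℕ
    recursive : Recursive char
    char-spec : ∀ xs → char xs ≡ 0 ⇔ P xs

open RecPred

private
  variable
    P Q : Vec ℕ n → Set

holds? : RecPred P → ∀ xs → Dec (P xs)
holds? R xs = map′ (to (char-spec R xs)) (from (char-spec R xs)) (char R xs ≟ 0)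

ifz-yes : (R : RecPred P) → ∀ xs → P xs → ∀ {a b} → ifz (char R xs) a b ≡ a
ifz-yes R xs p with char R xs | from (char-spec R xs) p
... | .0 | refl = refl

-- With 0 reserved for "no answer", a successor can only come from the first branch.
ifz-yes⁻¹ : (R : RecPred P) → ∀ xs {a y} → ifz (char R xs) a 0 ≡ suc y → P xs × a ≡ suc y
ifz-yes⁻¹ R xs eq with char R xs | char-spec R xs
... | zero | r = to r refl , eq

_∘ᴾ_ : RecPred P → RecursiveMap F → RecPred (P ∘ F)
R ∘ᴾ S = record
  { char = _ ; recursive = recursive R ∘ᴿ S ; char-spec = λ xs → char-spec R _ }

castᴾ : (∀ xs → P xs ⇔ Q xs) → RecPred P → RecPred Q
castᴾ P⇔Q R = record
  { char      = char R
  ; recursive = recursive R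
  ; char-spec = λ xs → mk⇔ (to (P⇔Q xs) ∘ to (char-spec R xs))
                           (from (char-spec R xs) ∘ from (P⇔Q xs))
  }

infix  4 _≤ᴾ_ _<ᴾ_ _≡ᴾ_
infixr 3 _×ᴾ_
infixr 2 _⊎ᴾ_

_≤ᴾ_ : Recursive f₁ → Recursive f₂ → RecPred (λ xs → f₁ xs ≤ f₂ xs)
R ≤ᴾ S = record
  { char      = _
  ; recursive = ∸ᴿ R S
  ; char-spec = λ xs → mk⇔ m∸n≡0⇒m≤n m≤n⇒m∸n≡0
  }

_<ᴾ_ : Recursive f₁ → Recursive f₂ → RecPred (λ xs → f₁ xs < f₂ xs)
R <ᴾ S = sucᴿ R ≤ᴾ S

¬ᴾ_ : RecPred P → RecPred (¬_ ∘ P)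
¬ᴾ_ {P = P} R = record
  { char      = λ xs → ifz (char R xs) 1 0
  ; recursive = ifzᴿ (recursive R) (constᴿ 1) zeroᴿ
  ; char-spec = spec
  }
  where
  spec : ∀ xs → ifz (char R xs) 1 0 ≡ 0 ⇔ (¬ P xs)
  spec xs with char R xs | char-spec R xs
  ... | zero  | r = mk⇔ (λ ()) (λ ¬p → contradiction (to r refl) ¬p)
  ... | suc _ | r = mk⇔ (λ _ p → contradiction (from r p) 1+n≢0) (λ _ → refl)

_×ᴾ_ : RecPred P → RecPred Q → RecPred (λ xs → P xs × Q xs)
_×ᴾ_ {P = P} {Q = Q} R S = record
  { char      = λ xs → ifz (char R xs) (char S xs) 1
  ; recursive = ifzᴿ (recursive R) (recursive S) (constᴿ 1)
  ; char-spec = spec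
  }
  where
  spec : ∀ xs → ifz (char R xs) (char S xs) 1 ≡ 0 ⇔ (P xs × Q xs)
  spec xs with char R xs | char-spec R xs
  ... | zero  | r = mk⇔ (λ eq → to r refl , to (char-spec S xs) eq)
                        (λ (_ , q) → from (char-spec S xs) q)
  ... | suc _ | r = mk⇔ (λ ()) (λ (p , _) → contradiction (from r p) 1+n≢0)

_⊎ᴾ_ : RecPred P → RecPred Q → RecPred (λ xs → P xs ⊎ Q xs)
_⊎ᴾ_ {P = P} {Q = Q} R S = record
  { char      = λ xs → ifz (char R xs) 0 (char S xs)
  ; recursive = ifzᴿ (recursive R) zeroᴿ (recursive S)
  ; char-spec = spec
  }
  where
  spec : ∀ xs → ifz (char R xs) 0 (char S xs) ≡ 0 ⇔ (P xs ⊎ Q xs)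
  spec xs with char R xs | char-spec R xs
  ... | zero  | r = mk⇔ (λ _ → inj₁ (to r refl)) (λ _ → refl)
  ... | suc _ | r =
    mk⇔ (inj₂ ∘ to (char-spec S xs))
        [ (λ p → contradiction (from r p) 1+n≢0) , from (char-spec S xs) ]′

_≡ᴾ_ : Recursive f₁ → Recursive f₂ → RecPred (λ xs → f₁ xs ≡ f₂ xs)
R ≡ᴾ S = castᴾ (λ xs → mk⇔ (λ (p , q) → ≤-antisym p q)
                           (λ eq → ≤-reflexive eq , ≤-reflexive (sym eq)))
               (R ≤ᴾ S ×ᴾ S ≤ᴾ R)

∃<ᴾ : Recursive f₁ → RecPred P → RecPred (λ xs → ∃[ y ] y < f₁ xs × P (y ∷ xs))
∃<ᴾ {f₁ = f₁} {P = P} S R = record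
  { char      = λ xs → scan xs (f₁ xs)
  ; recursive = primrecᴿ (constᴿ 1)
      (ifzᴿ (recursive R ∘ᴿ (var 0F ∷ᴿ tailᴿ (tailᴿ idᴿ))) zeroᴿ (var 1F)) S
  ; char-spec = λ xs → spec xs (f₁ xs)
  }
  where
  scan : Vec ℕ _ → ℕ → ℕ
  scan xs = primrec 1 (λ k r → ifz (char R (k ∷ xs)) 0 r)

  spec : ∀ xs b → scan xs b ≡ 0 ⇔ (∃[ y ] y < b × P (y ∷ xs))
  spec xs zero    = mk⇔ (λ ()) (λ ())
  spec xs (suc b) with char R (b ∷ xs) | char-spec R (b ∷ xs)
  ... | zero  | r = mk⇔ (λ _ → b , ≤-refl , to r refl) (λ _ → refl)
  ... | suc _ | r = mk⇔
    (λ eq → let y , y<b , p = to (spec xs b) eq in y , m<n⇒m<1+n y<b , p)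
    (λ (y , y<1+b , p) → from (spec xs b)
      (y , ≤∧≢⇒< (≤-pred y<1+b) (λ { refl → contradiction (from r p) 1+n≢0 }) , p))

-- Unbounded search

search : {P : Vec ℕ (suc n) → Set} → RecPred P → Code n
search R = mu (code (recursive R))

search⇓⇒ : {P : Vec ℕ (suc n) → Set} (R : RecPred P) → ∀ {xs y} →
           search R [ xs ]⇓ y → P (y ∷ xs)
search⇓⇒ R (mu⇓ _ c⇓) = to (char-spec R _) (⇓-functional (computes (recursive R) _) c⇓)

-- `mu` demands positive values before its result, so an arbitrary witness is first lowered to the
-- least one.
search⇓⇔ : {P : Vec ℕ (suc n) → Set} (R : RecPred P) → ∀ xs →
           (∃[ y ] search R [ xs ]⇓ y) ⇔ (∃[ t ] P (t ∷ xs))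
search⇓⇔ {P = P} R xs = mk⇔
  (λ (y , c⇓) → y , search⇓⇒ R c⇓)
  (λ (t , p) → minimum (least (λ k → holds? R (k ∷ xs)) t p))
  where
  c = code (recursive R)

  minimum : ∃[ l ] P (l ∷ xs) × (∀ k → k < l → ¬ P (k ∷ xs)) → ∃[ y ] search R [ xs ]⇓ y
  minimum (l , p , below) = l , mu⇓ (λ k k<l → below⇓ k (below k k<l))
    (subst (c [ l ∷ xs ]⇓_) (from (char-spec R _) p) (computes (recursive R) _))
    where
    below⇓ : ∀ k → ¬ P (k ∷ xs) → ∃[ w ] c [ k ∷ xs ]⇓ suc w
    below⇓ k ¬p = _ , subst (c [ k ∷ xs ]⇓_)
      (sym (suc-pred-≢0 (¬p ∘ to (char-spec R _)))) (computes (recursive R) _)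

-- The given witnesses only guarantee termination; the values are those of the search, so the
-- existence proof need not be computable.
minimise : {P : Vec ℕ (suc n) → Set} → RecPred P → (∀ xs → ∃[ y ] P (y ∷ xs)) →
           ∃[ μ ] Recursive μ × ∀ xs → P (μ xs ∷ xs)
minimise R inhabited =
  (λ xs → proj₁ (halts xs)) ,
  record { code = search R ; computes = λ xs → proj₂ (halts xs) } ,
  λ xs → search⇓⇒ R (proj₂ (halts xs))
  where
  halts : ∀ xs → ∃[ y ] search R [ xs ]⇓ y
  halts xs = from (search⇓⇔ R xs) (inhabited xs)

-- Step-indexed evaluation of codes

Eventually : (ℕ → Set) → Set
Eventually P = ∃[ T ] (∀ t → T ≤ t → P t)

always : ∀ {P} → (∀ t → P t) → Eventually P
always p = 0 , λ t _ → p t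

-- Results that hold from some time on, rather than at one time, let subcomputations be read at a
-- common time without any monotonicity of stages.
eventually₂ : ∀ {P Q R} → (∀ {t} → P t → Q t → R t) →
              Eventually P → Eventually Q → Eventually R
eventually₂ pqr (T , p) (U , q) =
  T ⊔ U , λ t le → pqr (p t (m⊔n≤o⇒m≤o T U le)) (q t (m⊔n≤o⇒n≤o T U le))

eventually-below : ∀ {P : ℕ → ℕ → Set} y → (∀ k → k < y → Eventually (P k)) →
                   Eventually (λ t → ∀ k → k < y → P k t)
eventually-below zero    ev = always (λ t k ())
eventually-below {P} (suc y) ev =
  eventually₂ join (eventually-below y (λ k k<y → ev k (m<n⇒m<1+n k<y))) (ev y ≤-refl)
  where
  join : ∀ {t} → (∀ k → k < y → P k t) → P y t → ∀ k → k < suc y → P k t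
  join below top k k<1+y with k ≟ y
  ... | yes refl = top
  ... | no  k≢y  = below k (≤∧≢⇒< (≤-pred k<1+y) k≢y)

-- stage (t ∷ xs) is 0 while no result is known at time t, and suc y once the result is y.

record Stages (G : Vec ℕ n → ℕ → Set) : Set where
  field
    stage    : Vec ℕ (suc n) → ℕ
    stageᴿ   : Recursive stage
    sound    : ∀ {t xs y} → stage (t ∷ xs) ≡ suc y → G xs y
    complete : ∀ {xs y} → G xs y → Eventually (λ t → stage (t ∷ xs) ≡ suc y)

-- A vector has no spare value for "unknown", so readiness is a separate predicate; before it holds,
-- `values` carries no information.
record MapStages (G : Vec ℕ n → Vec ℕ m → Set) : Set₁ where
  field
    Ready     : Vec ℕ (suc n) → Set
    ready     : RecPred Ready
    values    : Vec ℕ (suc n) → Vec ℕ m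
    valuesᴿ   : RecursiveMap values
    sound*    : ∀ {t xs} → Ready (t ∷ xs) → G xs (values (t ∷ xs))
    complete* : ∀ {xs ys} → G xs ys →
                Eventually (λ t → Ready (t ∷ xs) × values (t ∷ xs) ≡ ys)

open Stages
open MapStages

[_]⇓*_via_ : Vec ℕ n → Vec ℕ m → Vec (Code n) m → Set
[ xs ]⇓* ys via cs = ∀ i → lookup cs i [ xs ]⇓ lookup ys i

totalStages : ∀ {c : Code n} (R : Recursive f₁) → code R ≡ c → Stages (c [_]⇓_)
totalStages {f₁ = f} R refl = record
  { stage    = λ xs → suc (f (tail xs))
  ; stageᴿ   = sucᴿ (R ∘ᴿ tailᴿ idᴿ)
  ; sound    = λ { {xs = xs} refl → computes R xs }
  ; complete = λ c⇓ → always (λ _ → cong suc (⇓-functional (computes R _) c⇓))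
  }

[]-stages : MapStages {n} ([_]⇓*_via [])
[]-stages = record
  { Ready     = λ _ → 0 ≡ 0
  ; ready     = zeroᴿ ≡ᴾ zeroᴿ
  ; values    = λ _ → []
  ; valuesᴿ   = []ᴿ
  ; sound*    = λ _ ()
  ; complete* = λ { {ys = []} _ → always (λ _ → refl , refl) }
  }

∷-stages : ∀ {c : Code n} {cs : Vec (Code n) m} → Stages (c [_]⇓_) →
           MapStages ([_]⇓*_via cs) → MapStages ([_]⇓*_via (c ∷ cs))
∷-stages {c = c} {cs} S M = record
  { Ready     = λ xs → stage S xs ≢ 0 × Ready M xs
  ; ready     = ¬ᴾ (stageᴿ S ≡ᴾ zeroᴿ) ×ᴾ ready M
  ; values    = λ xs → pred (stage S xs) ∷ values M xs
  ; valuesᴿ   = predᴿ (stageᴿ S) ∷ᴿ valuesᴿ M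
  ; sound*    = sound′
  ; complete* = λ { {ys = y ∷ ys} c⇓ →
      eventually₂ join (complete S (c⇓ zero)) (complete* M (c⇓ ∘ suc)) }
  }
  where
  sound′ : ∀ {t xs} → stage S (t ∷ xs) ≢ 0 × Ready M (t ∷ xs) →
           [ xs ]⇓* (pred (stage S (t ∷ xs)) ∷ values M (t ∷ xs)) via (c ∷ cs)
  sound′ (≢0 , _)    zero    = sound S (sym (suc-pred-≢0 ≢0))
  sound′ (_ , known) (suc i) = sound* M known i

  join : ∀ {xs y ys t} → stage S (t ∷ xs) ≡ suc y →
         Ready M (t ∷ xs) × values M (t ∷ xs) ≡ ys →
         (stage S (t ∷ xs) ≢ 0 × Ready M (t ∷ xs)) ×
         pred (stage S (t ∷ xs)) ∷ values M (t ∷ xs) ≡ y ∷ ys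
  join eq (known , eqs) =
    ((λ ≡0 → 1+n≢0 (trans (sym eq) ≡0)) , known) , cong₂ _∷_ (cong pred eq) eqs

comp-stages : ∀ {f : Code m} {gs : Vec (Code n) m} → Stages (f [_]⇓_) →
              MapStages ([_]⇓*_via gs) → Stages (comp f gs [_]⇓_)
comp-stages {m} {n} {f} {gs} S M = record
  { stage    = at
  ; stageᴿ   = ifzᴿ (recursive (ready M)) (stageᴿ S ∘ᴿ (var 0F ∷ᴿ valuesᴿ M)) zeroᴿ
  ; sound    = λ {t} {xs} → sound′ {t} {xs}
  ; complete = λ { (comp⇓ gs⇓ f⇓) → eventually₂ join (complete S f⇓) (complete* M gs⇓) }
  }
  where
  at : Vec ℕ (suc n) → ℕ
  at xs = ifz (char (ready M) xs) (stage S (lookup xs 0F ∷ values M xs)) 0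

  sound′ : ∀ {t xs y} → at (t ∷ xs) ≡ suc y → comp f gs [ xs ]⇓ y
  sound′ eq with known , eq′ ← ifz-yes⁻¹ (ready M) _ eq = comp⇓ (sound* M known) (sound S eq′)

  join : ∀ {xs ys y t} → stage S (t ∷ ys) ≡ suc y →
         Ready M (t ∷ xs) × values M (t ∷ xs) ≡ ys → at (t ∷ xs) ≡ suc y
  join eq (known , refl) = trans (ifz-yes (ready M) _ known) eq

prec-stages : ∀ {f : Code n} {g : Code (suc (suc n))} → Stages (f [_]⇓_) →
              Stages (g [_]⇓_) → Stages (prec f g [_]⇓_)
prec-stages {n} {f} {g} S T = record
  { stage    = λ xs → run (lookup xs 0F) (tail (tail xs)) (lookup xs 1F)
  ; stageᴿ   = primrecᴿ
      (stageᴿ S ∘ᴿ (var 0F ∷ᴿ tailᴿ (tailᴿ idᴿ)))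
      (ifzᴿ (var 1F) zeroᴿ
        -- The context is j, r, t, k, followed by the parameters.
        (stageᴿ T ∘ᴿ (var 2F ∷ᴿ var 0F ∷ᴿ predᴿ (var 1F)
                    ∷ᴿ tailᴿ (tailᴿ (tailᴿ (tailᴿ idᴿ))))))
      (var 1F)
  ; sound    = λ { {xs = k ∷ xs} → sound′ k }
  ; complete = λ { {xs = k ∷ xs} → complete′ }
  }
  where
  run : ℕ → Vec ℕ n → ℕ → ℕ
  -- A known previous value y appears as r = suc y, hence `pred r`; an unknown one keeps all later
  -- ones unknown.
  run t xs = primrec (stage S (t ∷ xs)) (λ j r → ifz r 0 (stage T (t ∷ j ∷ pred r ∷ xs)))

  sound′ : ∀ k {t xs y} → run t xs k ≡ suc y → prec f g [ k ∷ xs ]⇓ y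
  sound′ zero    eq = prec0⇓ (sound S eq)
  sound′ (suc k) {t} {xs} eq with run t xs k in eqr
  ... | suc r = precS⇓ (sound′ k eqr) (sound T eq)

  join : ∀ {t xs k y z} → run t xs k ≡ suc y → stage T (t ∷ k ∷ y ∷ xs) ≡ suc z →
         run t xs (suc k) ≡ suc z
  join {t} {xs} {k} eq eq′ rewrite eq = eq′

  complete′ : ∀ {xs y} → prec f g [ xs ]⇓ y →
              Eventually (λ t → run t (tail xs) (head xs) ≡ suc y)
  complete′ (prec0⇓ f⇓) = complete S f⇓
  complete′ (precS⇓ {k = k} r⇓ g⇓) =
    eventually₂ (λ {t} → join {t} {k = k}) (complete′ r⇓) (complete T g⇓)

mu-stages : ∀ {f : Code (suc n)} → Stages (f [_]⇓_) → Stages (mu f [_]⇓_)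
mu-stages {n} {f} S = record
  -- Time also bounds the scan. `pred` turns both "positive so far" and "stuck" into "unknown", and
  -- 2 + y into suc y.
  { stage    = λ xs → pred (scan (lookup xs 0F) (tail xs) (lookup xs 0F))
  ; stageᴿ   = predᴿ (primrecᴿ zeroᴿ
      (ifzᴿ (var 1F)
        (ifzᴿ stage-at (constᴿ 1) (ifzᴿ (predᴿ stage-at) (sucᴿ (sucᴿ (var 0F))) zeroᴿ))
        (var 1F))
      (var 0F))
  ; sound    = λ {t} {xs} {y} eq → proj₂ (sound′ t xs t) y (unpred eq)
  ; complete = complete′
  }
  where
  stage-at : Recursive (λ (xs : Vec ℕ (3 + n)) →
    stage S (lookup xs 2F ∷ lookup xs 0F ∷ tail (tail (tail xs))))
  stage-at = stageᴿ S ∘ᴿ (var 2F ∷ᴿ var 0F ∷ᴿ tailᴿ (tailᴿ (tailᴿ idᴿ)))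

  -- 0: all values so far are known and positive; 1: stuck; 2 + y: the first zero is y
  verdict : ℕ → ℕ → ℕ
  verdict j s = ifz s 1 (ifz (pred s) (suc (suc j)) 0)

  scan : ℕ → Vec ℕ n → ℕ → ℕ
  scan t xs = primrec 0 (λ j r → ifz r (verdict j (stage S (t ∷ j ∷ xs))) r)

  unpred : ∀ {k y} → pred k ≡ suc y → k ≡ suc (suc y)
  unpred {suc k} refl = refl

  Positive : Vec ℕ n → ℕ → Set
  Positive xs k = ∀ j → j < k → ∃[ w ] f [ j ∷ xs ]⇓ suc w

  -- The two claims need a joint induction: a zero at k is the least one only because state 0
  -- certifies positive values at all earlier arguments.
  sound′ : ∀ t xs k → (scan t xs k ≡ 0 → Positive xs k) ×
                      (∀ y → scan t xs k ≡ suc (suc y) → mu f [ xs ]⇓ y)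
  sound′ t xs zero = (λ _ j ()) , λ _ ()
  sound′ t xs (suc k) with scan t xs k | sound′ t xs k
  ... | suc r | _ , found = (λ ()) , found
  ... | zero  | positive , _ with stage S (t ∷ k ∷ xs) in eq
  ...   | zero        = (λ ()) , λ _ ()
  ...   | suc zero    = (λ ()) , λ { _ refl → mu⇓ (positive refl) (sound S eq) }
  ...   | suc (suc w) = (λ _ → extend) , λ _ ()
    where
    extend : Positive xs (suc k)
    extend j j<1+k with j ≟ k
    ... | yes refl = w , sound S eq
    ... | no  j≢k  = positive refl j (≤∧≢⇒< (≤-pred j<1+k) j≢k)

  scan-positive : ∀ t xs y → (∀ k → k < y → ∃[ w ] stage S (t ∷ k ∷ xs) ≡ suc (suc w)) →
                  scan t xs y ≡ 0
  scan-positive t xs zero    pos = refl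
  scan-positive t xs (suc y) pos
    with scan t xs y | scan-positive t xs y (λ k k<y → pos k (m<n⇒m<1+n k<y))
       | stage S (t ∷ y ∷ xs) | pos y ≤-refl
  ... | .0 | refl | .(suc (suc w)) | w , refl = refl

  scan-found : ∀ t xs y → scan t xs y ≡ 0 → stage S (t ∷ y ∷ xs) ≡ 1 →
               ∀ k → y < k → scan t xs k ≡ suc (suc y)
  scan-found t xs y none zero-at (suc k) y<1+k with y ≟ k
  ... | yes refl rewrite none | zero-at = refl
  ... | no  y≢k
    rewrite scan-found t xs y none zero-at k (≤∧≢⇒< (≤-pred y<1+k) y≢k) = refl

  complete′ : ∀ {xs y} → mu f [ xs ]⇓ y →
              Eventually (λ t → pred (scan t xs t) ≡ suc y)
  complete′ {xs} {y} (mu⇓ below f⇓) =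
    eventually₂ (λ {t} y<t (pos , zero-at) →
                  cong pred (scan-found t xs y (scan-positive t xs y pos) zero-at t y<t))
      -- The scan at time t inspects only arguments below t, so t must exceed y.
      (suc y , λ t y<t → y<t)
      (eventually₂ _,_
        (eventually-below y λ k k<y → let w , k⇓ = below k k<y ; T , st = complete S k⇓
                                      in T , λ t T≤t → w , st t T≤t)
        (complete S f⇓))

mutual
  stages : (c : Code n) → Stages (c [_]⇓_)
  stages zer         = totalStages {f₁ = λ _ → 0}
                         (record { code = zer ; computes = λ { [] → zer⇓ } }) refl
  stages succ        = totalStages {f₁ = λ xs → suc (head xs)}
                         (record { code = succ ; computes = λ { (_ ∷ []) → succ⇓ } }) refl
  stages (proj i)    = totalStages (var i) refl
  stages (comp f gs) = comp-stages (stages f) (stages* gs)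
  stages (prec f g)  = prec-stages (stages f) (stages g)
  stages (mu f)      = mu-stages (stages f)

  stages* : (cs : Vec (Code n) m) → MapStages ([_]⇓*_via cs)
  stages* []       = []-stages
  stages* (c ∷ cs) = ∷-stages (stages c) (stages* cs)

-- Σ₁ predicates

record Σ₁ (P : Vec ℕ n → Set) : Set₁ where
  field
    Matrix  : Vec ℕ (suc n) → Set
    matrix  : RecPred Matrix
    Σ₁-spec : ∀ xs → P xs ⇔ (∃[ t ] Matrix (t ∷ xs))

halting-Σ₁ : (c : Code n) → Σ₁ (λ xs → ∃[ y ] c [ xs ]⇓ y)
halting-Σ₁ c = record
  { Matrix  = λ xs → stage S xs ≢ 0
  ; matrix  = ¬ᴾ (stageᴿ S ≡ᴾ zeroᴿ)
  ; Σ₁-spec = λ xs → mk⇔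
      (λ (y , c⇓) → let T , st = complete S c⇓ in
         T , λ ≡0 → 1+n≢0 (trans (sym (st T ≤-refl)) ≡0))
      (λ (t , ≢0) → _ , sound S (sym (suc-pred-≢0 ≢0)))
  }
  where S = stages c

-- Inflationary reductions and the effective Schröder-Bernstein theorem

Recursive₁ : (ℕ → ℕ) → Set
Recursive₁ f = Recursive {1} (f $ⁿ_)

record _≼_ (ν μ : ℕ → Pred ℕ 0ℓ) : Set where
  field
    reduce       : ℕ → ℕ
    reduceᴿ      : Recursive₁ reduce
    injective    : Injective _≡_ _≡_ reduce
    inflationary : ∀ x → x < reduce x
    correct      : ∀ x → ν x ≐ μ (reduce x)

-- Inflationary injections have decidable ranges, so the Schröder–Bernstein bijection
-- can be computed.

module SchröderBernstein {ν μ : ℕ → Pred ℕ 0ℓ} (ν≼μ : ν ≼ μ) (μ≼ν : μ ≼ ν) where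
  open _≼_ ν≼μ renaming (reduce to f; reduceᴿ to fᴿ; injective to f-injective;
                         inflationary to f-inflationary; correct to f-correct)
  open _≼_ μ≼ν renaming (reduce to g; reduceᴿ to gᴿ; injective to g-injective;
                         inflationary to g-inflationary; correct to g-correct)

  tower : ℕ → ℕ → ℕ
  tower k z = primrec z (λ _ r → g (f r)) k

  -- Each application of g ∘ f adds at least one; this bounds both quantifiers in `Descends`.
  tower-bound : ∀ k z → k + z ≤ tower k z
  tower-bound zero    z = ≤-refl
  tower-bound (suc k) z =
    ≤-trans (s≤s (tower-bound k z)) (≤-trans (f-inflationary _) (<⇒≤ (g-inflationary _)))

  -- The backward chain of x, alternately inverting g and f, stops at some y outside the range of f.
  -- On these x the bijection has to be the inverse of g.
  Descends : ℕ → Set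
  Descends x = ∃[ k ] ∃[ y ] (∀ x′ → f x′ ≢ y) × tower k (g y) ≡ x

  descendsᴾ : RecPred {1} (λ xs → Descends (lookup xs 0F))
  descendsᴾ = castᴾ spec
    (∃<ᴾ (var 0F) (∃<ᴾ (var 1F)
      (¬ᴾ ∃<ᴾ (var 0F) (app₁ fᴿ (var 0F) ≡ᴾ var 1F) ×ᴾ
       primrecᴿ (app₁ gᴿ (var 0F)) (app₁ gᴿ (app₁ fᴿ (var 1F))) (var 1F) ≡ᴾ var 2F)))
    where
    spec : ∀ (xs : Vec ℕ 1) → let x = lookup xs 0F in
           (∃[ k ] k < x × ∃[ y ] y < x × ¬ (∃[ x′ ] x′ < y × f x′ ≡ y) × tower k (g y) ≡ x)
           ⇔ Descends x
    spec (x ∷ []) = mk⇔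
      (λ (k , _ , y , _ , y∉f , eq) →
        k , y , (λ x′ eq′ → y∉f (x′ , subst (x′ <_) eq′ (f-inflationary x′) , eq′)) , eq)
      (λ { (k , y , y∉f , refl) →
        k , ≤-trans (≤-trans (≤-reflexive (+-comm 1 k))
                (+-monoʳ-≤ k (≤-trans (s≤s z≤n) (g-inflationary y))))
              (tower-bound k (g y)) ,
        y , ≤-trans (g-inflationary y) (≤-trans (m≤n+m (g y) k) (tower-bound k (g y))) ,
        (λ (x′ , _ , eq′) → y∉f x′ eq′) , refl })

  descends? : ∀ x → Dec (Descends x)
  descends? x = holds? descendsᴾ (x ∷ [])

  descends⇒range : ∀ {x} → Descends x → ∃[ y ] g y ≡ x
  descends⇒range (zero  , y , _ , refl) = y , refl
  descends⇒range (suc k , y , _ , refl) = _ , refl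

  descends-gf : ∀ {x} → Descends x → Descends (g (f x))
  descends-gf (k , y , y∉f , refl) = suc k , y , y∉f , refl

  descends-gf⁻¹ : ∀ {x} → Descends (g (f x)) → Descends x
  descends-gf⁻¹ (zero  , y , y∉f , eq) = contradiction (sym (g-injective eq)) (y∉f _)
  descends-gf⁻¹ (suc k , y , y∉f , eq) = k , y , y∉f , f-injective (g-injective eq)

  -- A y outside the range of f would itself start the chain of `g y`; the bounded search for a
  -- preimage removes the double negation.
  ¬descends-g : ∀ {y} → ¬ Descends (g y) → ∃[ x ] f x ≡ y
  ¬descends-g {y} ¬d = let x , _ , eq = decidable-stable range? in-range in x , eq
    where
    range? : Dec (∃[ x ] x < y × f x ≡ y)
    range? = anyUpTo? (λ x → f x ≟ y) y

    in-range : ¬ ¬ (∃[ x ] x < y × f x ≡ y)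
    in-range none = ¬d
      (0 , y , (λ x eq → none (x , subst (x <_) eq (f-inflationary x) , eq)) , refl)

  -- The bijection is given as a decidable graph: `minimise` then computes it, and g need not be
  -- inverted explicitly.
  Partner : ℕ → ℕ → Set
  Partner x z = (Descends x × g z ≡ x) ⊎ (¬ Descends x × f x ≡ z)

  partner : ∀ x → ∃[ z ] Partner x z
  partner x with descends? x
  ... | yes d = let y , eq = descends⇒range d in y , inj₁ (d , eq)
  ... | no ¬d = f x , inj₂ (¬d , refl)

  partner-injective : ∀ {x x′ z} → Partner x z → Partner x′ z → x ≡ x′
  partner-injective (inj₁ (_ , refl)) (inj₁ (_ , refl)) = refl
  partner-injective (inj₂ (_ , refl)) (inj₂ (_ , eq))   = f-injective (sym eq)
  -- Here x is g (f x′), and `Descends` is invariant under g ∘ f.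
  partner-injective (inj₁ (d , refl)) (inj₂ (¬d , refl)) = contradiction (descends-gf⁻¹ d) ¬d
  partner-injective (inj₂ (¬d , refl)) (inj₁ (d , refl)) = contradiction (descends-gf⁻¹ d) ¬d

  partner-functional : ∀ {x z z′} → Partner x z → Partner x z′ → z ≡ z′
  partner-functional (inj₁ (_ , refl)) (inj₁ (_ , eq)) = g-injective (sym eq)
  partner-functional (inj₁ (d , _)) (inj₂ (¬d , _))    = contradiction d ¬d
  partner-functional (inj₂ (¬d , _)) (inj₁ (d , _))    = contradiction d ¬d
  partner-functional (inj₂ (_ , refl)) (inj₂ (_ , refl)) = refl

  partner-surjective : ∀ z → ∃[ x ] Partner x z
  partner-surjective z with descends? (g z)
  ... | yes d = g z , inj₁ (d , refl)
  ... | no ¬d with x , refl ← ¬descends-g ¬d = x , inj₂ (¬d ∘ descends-gf , refl)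

  partner-correct : ∀ {x z} → Partner x z → ν x ≐ μ z
  partner-correct (inj₁ (_ , refl)) = let p , q = g-correct _ in q , p
  partner-correct (inj₂ (_ , refl)) = f-correct _

  partnerᴾ : RecPred {2} (λ xs → Partner (lookup xs 1F) (lookup xs 0F))
  partnerᴾ =
    (descendsᴾ ∘ᴾ (var 1F ∷ᴿ []ᴿ) ×ᴾ app₁ gᴿ (var 0F) ≡ᴾ var 1F) ⊎ᴾ
    (¬ᴾ (descendsᴾ ∘ᴾ (var 1F ∷ᴿ []ᴿ)) ×ᴾ app₁ fᴿ (var 1F) ≡ᴾ var 0F)

  isomorphic : ComputablyIsomorphic ν μ
  isomorphic = bijection (minimise partnerᴾ (λ { (x ∷ []) → partner x }))
    where
    bijection : ∃[ e ] Recursive {1} e × (∀ xs → Partner (lookup xs 0F) (e xs)) →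
                ComputablyIsomorphic ν μ
    bijection (e , eᴿ , e-spec) =
      (λ x → e (x ∷ [])) ,
      toComputable (cast (λ { (x ∷ []) → refl }) eᴿ) ,
      ( (λ {x} {x′} eq → partner-injective (e-spec (x ∷ []))
          (subst (Partner x′) (sym eq) (e-spec (x′ ∷ []))))
      , λ z → let x , p = partner-surjective z in
          x , λ { refl → partner-functional (e-spec (x ∷ [])) p }) ,
      λ x → partner-correct (e-spec (x ∷ []))

UniformlyΣ₁ : (ℕ → Pred ℕ 0ℓ) → Set₁
UniformlyΣ₁ V = Σ₁ {2} (λ xs → lookup xs 1F ∈ V (lookup xs 0F))

-- Recursive inverses of the pairing

module Unpairing (P : Pairing) where
  open Pairing P public using (⟨_,_⟩; y≤⟨x,y⟩)
  open Pairing P using (bijective; computable)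

  π₁ π₂ : ℕ → ℕ
  π₁ z = proj₁ (proj₁ (proj₂ bijective z))
  π₂ z = proj₂ (proj₁ (proj₂ bijective z))

  ⟨π₁,π₂⟩ : ∀ z → ⟨ π₁ z , π₂ z ⟩ ≡ z
  ⟨π₁,π₂⟩ z = proj₂ (proj₂ bijective z) refl

  ⟨,⟩-injective : ∀ {x y x′ y′} → ⟨ x , y ⟩ ≡ ⟨ x′ , y′ ⟩ → x ≡ x′ × y ≡ y′
  ⟨,⟩-injective eq with refl ← proj₁ bijective eq = refl , refl

  π₁-⟨⟩ : ∀ x y → π₁ ⟨ x , y ⟩ ≡ x
  π₁-⟨⟩ x y = proj₁ (⟨,⟩-injective (⟨π₁,π₂⟩ ⟨ x , y ⟩))

  π₂-⟨⟩ : ∀ x y → π₂ ⟨ x , y ⟩ ≡ y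
  π₂-⟨⟩ x y = proj₂ (⟨,⟩-injective (⟨π₁,π₂⟩ ⟨ x , y ⟩))

  ⟨_,_⟩ᴿ : Recursive f₁ → Recursive f₂ → Recursive (λ xs → ⟨ f₁ xs , f₂ xs ⟩)
  ⟨ R , S ⟩ᴿ = app₂ (fromComputable computable) R S

  private
    -- A projection read off the surjectivity proof comes with no code, so it is recovered by
    -- search; `y≤⟨x,y⟩` bounds the other component.
    π₁-choice : ∃[ μ ] Recursive {1} μ × ∀ xs →
                ∃[ y ] y < suc (lookup xs 0F) × ⟨ μ xs , y ⟩ ≡ lookup xs 0F
    π₁-choice = minimise
      (∃<ᴾ (sucᴿ (var 1F)) (⟨ var 1F , var 0F ⟩ᴿ ≡ᴾ var 2F))
      (λ { (z ∷ []) → π₁ z , π₂ z ,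
           s≤s (≤-trans (y≤⟨x,y⟩ (π₁ z) (π₂ z)) (≤-reflexive (⟨π₁,π₂⟩ z))) , ⟨π₁,π₂⟩ z })

    abstract
      π₁-recursive : Recursive₁ π₁
      π₁-recursive = let μ , μᴿ , μ-spec = π₁-choice in
        cast (λ { (z ∷ []) → let _ , _ , eq = μ-spec (z ∷ []) in
                    sym (trans (cong π₁ (sym eq)) (π₁-⟨⟩ _ _)) }) μᴿ

    π₂-choice : ∃[ μ ] Recursive {1} μ × ∀ xs →
                ⟨ π₁ (lookup xs 0F) , μ xs ⟩ ≡ lookup xs 0F
    π₂-choice = minimise
      (⟨ app₁ π₁-recursive (var 1F) , var 0F ⟩ᴿ ≡ᴾ var 1F)
      (λ { (z ∷ []) → π₂ z , ⟨π₁,π₂⟩ z })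

    abstract
      π₂-recursive : Recursive₁ π₂
      π₂-recursive = let μ , μᴿ , μ-spec = π₂-choice in
        cast (λ { (z ∷ []) → sym (trans (cong π₂ (sym (μ-spec (z ∷ [])))) (π₂-⟨⟩ _ _)) }) μᴿ

  π₁ᴿ : Recursive f₁ → Recursive (λ xs → π₁ (f₁ xs))
  π₁ᴿ = app₁ π₁-recursive

  π₂ᴿ : Recursive f₁ → Recursive (λ xs → π₂ (f₁ xs))
  π₂ᴿ = app₁ π₂-recursive

distinct⇒injective : ∀ {h : ℕ → ℕ} → (∀ {m n} → m < n → h m ≢ h n) → Injective _≡_ _≡_ h
distinct⇒injective distinct {m} {n} eq with <-cmp m n
... | tri< m<n _ _ = contradiction eq (distinct m<n)
... | tri≈ _ m≡n _ = m≡n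
... | tri> _ _ n<m = contradiction (sym eq) (distinct n<m)

-- Pigeonhole: 2 + b distinct values cannot all lie among the 1 + b numbers up to b. The bound on j
-- makes the search decidable.
unbounded : ∀ {h : ℕ → ℕ} → Injective _≡_ _≡_ h → ∀ b → ∃[ j ] b < h j
unbounded {h} h-injective b =
  let j , _ , b<hj = decidable-stable (anyUpTo? (λ j → b <? h j) (2 + b)) found in j , b<hj
  where
  found : ¬ ¬ (∃[ j ] j < 2 + b × b < h j)
  found none = 1+n≰n (injective⇒≤ {f = bounded} bounded-injective)
    where
    small : ∀ (i : Fin (2 + b)) → h (toℕ i) < 1 + b
    small i = s≤s (≮⇒≥ λ b<h → none (toℕ i , toℕ<n i , b<h))

    bounded : Fin (2 + b) → Fin (1 + b)
    bounded i = fromℕ< (small i)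

    bounded-injective : Injective _≡_ _≡_ bounded
    bounded-injective {i} {j} eq =
      toℕ-injective (h-injective (fromℕ<-injective _ _ (small i) (small j) eq))

-- Gödel numberings: recursion theorem and injective reductions

module GödelNumbering (P : Pairing) {φ : ℕ → Partial 1} (gödel : IsGödelNumbering φ) where
  open Unpairing P
  open IsGödelNumbering gödel
  open IsNumberingOf isNumbering

  dom-Σ₁ : UniformlyΣ₁ (λ i → Dom (φ i))
  dom-Σ₁ with c , eq ← computable = record
    { Matrix  = Matrix
    ; matrix  = matrix
    ; Σ₁-spec = λ { xs@(_ ∷ _ ∷ []) → mk⇔
        (λ (y , gr) → to (Σ₁-spec xs) (y , to (eq xs y) gr))
        (λ ∃t → let y , c⇓ = from (Σ₁-spec xs) ∃t in y , from (eq xs y) c⇓) }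
    }
    where open Σ₁ (halting-Σ₁ c)

  selfApply : (u : Code 2) → Code 2
  selfApply u = comp u (code (π₁ᴿ (var {2} 0F)) ∷ code ⟨ var {2} 0F , var 1F ⟩ᴿ ∷ [])

  selfApply⇓⇔ : ∀ u {z x y} → selfApply u [ z ∷ x ∷ [] ]⇓ y ⇔ u [ π₁ z ∷ ⟨ z , x ⟩ ∷ [] ]⇓ y
  selfApply⇓⇔ u {z} {x} {y} = mk⇔ fwd (comp⇓ args)
    where
    args : ∀ i → lookup (code (π₁ᴿ (var {2} 0F)) ∷ code ⟨ var {2} 0F , var 1F ⟩ᴿ ∷ []) i
                   [ z ∷ x ∷ [] ]⇓ lookup (π₁ z ∷ ⟨ z , x ⟩ ∷ []) i
    args 0F = computes (π₁ᴿ (var 0F)) _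
    args 1F = computes ⟨ var 0F , var 1F ⟩ᴿ _

    fwd : selfApply u [ z ∷ x ∷ [] ]⇓ y → u [ π₁ z ∷ ⟨ z , x ⟩ ∷ [] ]⇓ y
    fwd (comp⇓ {ys = a ∷ b ∷ []} args′ u⇓) =
      subst (λ ys → u [ ys ]⇓ y)
        (cong₂ (λ a b → a ∷ b ∷ []) (⇓-functional (args′ 0F) (args 0F))
                                    (⇓-functional (args′ 1F) (args 1F))) u⇓

  private
    u : Code 2
    u = proj₁ computable

    diagonal : ∃[ s ] Computable 1 s ×
      (∀ i x y → Graph (φ (s i)) [ x ] y ⇔ Graph ⟦ selfApply u ⟧ (i ∷ x ∷ []) y)
    diagonal = s-m-n ⟦ selfApply u ⟧ (selfApply u , λ xs y → mk⇔ id id)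

  -- φ (s ⟨ d , m ⟩) runs program d on its own index d, as in Kleene's recursion theorem.
  s : ℕ → ℕ
  s = proj₁ diagonal

  sᴿ : Recursive₁ s
  sᴿ = fromComputable (proj₁ (proj₂ diagonal))

  s-spec : ∀ d m x y → Graph (φ (s ⟨ d , m ⟩)) [ x ] y ⇔ Graph (φ d) [ ⟨ ⟨ d , m ⟩ , x ⟩ ] y
  s-spec d m x y = subst (λ e → Graph (φ (s z)) [ x ] y ⇔ Graph (φ e) [ ⟨ z , x ⟩ ] y) (π₁-⟨⟩ d m)
    (mk⇔ (from (proj₂ computable _ y) ∘ to (selfApply⇓⇔ u) ∘ to (proj₂ (proj₂ diagonal) z x y))
         (from (proj₂ (proj₂ diagonal) z x y) ∘ from (selfApply⇓⇔ u) ∘ to (proj₂ computable _ y)))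
    where z = ⟨ d , m ⟩

  -- Since D sees e, it may mention every index `s ⟨ e , m ⟩` of the family being defined. As `s`
  -- already performs the self-application, e is just an index of the search for D that decodes e
  -- and m from its input.
  recursion : ∀ {D : Vec ℕ 4 → Set} → RecPred D →
    ∃[ e ] (∀ m x → x ∈ Dom (φ (s ⟨ e , m ⟩)) ⇔ (∃[ t ] D (t ∷ e ∷ m ∷ x ∷ [])))
  recursion {D} R = e , λ m x → mk⇔ (fwd m x) (bwd m x)
    where
    R′ : RecPred {2} (λ xs → D (lookup xs 0F ∷ π₁ (π₁ (lookup xs 1F)) ∷
                                π₂ (π₁ (lookup xs 1F)) ∷ π₂ (lookup xs 1F) ∷ []))
    R′ = R ∘ᴾ (var 0F ∷ᴿ π₁ᴿ (π₁ᴿ (var 1F)) ∷ᴿ π₂ᴿ (π₁ᴿ (var 1F)) ∷ᴿ π₂ᴿ (var 1F) ∷ᴿ []ᴿ)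

    searching : ∃[ i ] φ i ≈ ⟦ search R′ ⟧
    searching = onto ⟦ search R′ ⟧ (search R′ , λ xs y → mk⇔ id id)

    e : ℕ
    e = proj₁ searching

    unpack : ∀ t m x → D (t ∷ π₁ (π₁ ⟨ ⟨ e , m ⟩ , x ⟩) ∷ π₂ (π₁ ⟨ ⟨ e , m ⟩ , x ⟩) ∷
                            π₂ ⟨ ⟨ e , m ⟩ , x ⟩ ∷ []) ≡ D (t ∷ e ∷ m ∷ x ∷ [])
    unpack t m x rewrite π₁-⟨⟩ ⟨ e , m ⟩ x | π₂-⟨⟩ ⟨ e , m ⟩ x | π₁-⟨⟩ e m | π₂-⟨⟩ e m = refl

    fwd : ∀ m x → x ∈ Dom (φ (s ⟨ e , m ⟩)) → ∃[ t ] D (t ∷ e ∷ m ∷ x ∷ [])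
    fwd m x (y , gr) = y , subst id (unpack y m x)
      (search⇓⇒ R′ (to (proj₂ searching _ y) (to (s-spec e m x y) gr)))

    bwd : ∀ m x → ∃[ t ] D (t ∷ e ∷ m ∷ x ∷ []) → x ∈ Dom (φ (s ⟨ e , m ⟩))
    bwd m x (t , p) =
      let y , c⇓ = from (search⇓⇔ R′ (⟨ ⟨ e , m ⟩ , x ⟩ ∷ []))
                     (t , subst id (sym (unpack t m x)) p)
      in y , from (s-spec e m x y) (from (proj₂ searching _ y) c⇓)

  module _ {ν : ℕ → Pred ℕ 0ℓ} {r : ℕ → ℕ} (rᴿ : Recursive₁ r)
           (r-correct : ∀ i → Dom (φ i) ≐ ν (r i)) where

    -- By the recursion theorem, h m can be chosen so that its set is empty if h m repeats
    -- an earlier value, and everything if a later value repeats h m; hence no value repeats.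

    injective-reduction : ∀ {V : ℕ → Pred ℕ 0ℓ} → UniformlyΣ₁ V →
      ∃[ h ] Recursive₁ h × Injective _≡_ _≡_ h × (∀ m → V m ≐ ν (h m))
    injective-reduction {V} V-Σ₁ =
      h , cast (λ { (m ∷ []) → refl }) (hᴿ (constᴿ e) (var {1} 0F)) ,
      distinct⇒injective (λ {m} {m′} m<m′ eq → no-repeat m′ (m , m<m′ , eq)) ,
      λ m → (λ {x} v → let t , M = to (Σ₁-spec _) v
                       in from (member m x) (t , no-repeat m , inj₁ M))
          , λ {x} p → [ from (Σ₁-spec _) ∘ (_ ,_)
                      , (λ (m<t , eq) → contradiction (m , m<t , sym eq) (no-repeat _)) ]′
                      (proj₂ (proj₂ (to (member m x) p)))
      where
      open Σ₁ V-Σ₁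

      hᴿ : ∀ {f g : Vec ℕ n → ℕ} → Recursive f → Recursive g →
           Recursive (λ xs → r (s ⟨ f xs , g xs ⟩))
      hᴿ R S = app₁ rᴿ (app₁ sᴿ ⟨ R , S ⟩ᴿ)

      -- The variables are t, e, m, x. The number t serves both as a witness of x ∈ V m and as the
      -- position of a later repetition of h m.
      fixpoint = recursion
        (¬ᴾ ∃<ᴾ (var 2F) (hᴿ (var 2F) (var 0F) ≡ᴾ hᴿ (var 2F) (var 3F)) ×ᴾ
         (matrix ∘ᴾ (var 0F ∷ᴿ var 2F ∷ᴿ var 3F ∷ᴿ []ᴿ) ⊎ᴾ
          var 2F <ᴾ var 0F ×ᴾ hᴿ (var 1F) (var 0F) ≡ᴾ hᴿ (var 1F) (var 2F)))

      e : ℕ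
      e = proj₁ fixpoint

      h : ℕ → ℕ
      h m = r (s ⟨ e , m ⟩)

      Repeat : ℕ → Set
      Repeat m = ∃[ m′ ] m′ < m × h m′ ≡ h m

      member : ∀ m x → x ∈ ν (h m) ⇔
        (∃[ t ] ¬ Repeat m × (Matrix (t ∷ m ∷ x ∷ []) ⊎ (m < t × h t ≡ h m)))
      member m x = mk⇔ (to (proj₂ fixpoint m x) ∘ proj₂ (r-correct _))
                       (proj₁ (r-correct _) ∘ from (proj₂ fixpoint m x))

      no-repeat : ∀ m → ¬ Repeat m
      no-repeat = <-rec _ λ m none (m′ , m′<m , eq) →
        -- By induction m′ repeats nothing, so its repetition at m puts 0 into ν (h m′). This is
        -- also the set of m, which has elements only if m is no repeat.
        let everything = from (member m′ 0) (m , none m′<m , inj₂ (m′<m , sym eq))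
            _ , ¬repeat , _ = to (member m 0) (subst (λ k → 0 ∈ ν k) eq everything)
        in ¬repeat (m′ , m′<m , eq)

    -- Reducing V ∘ π₁ instead of V gives every x infinitely many distinct images, so one exceeds x;
    -- the pairs keep different x apart.
    reduction : ∀ {V : ℕ → Pred ℕ 0ℓ} → UniformlyΣ₁ V → V ≼ ν
    reduction {V} V-Σ₁ = padded (injective-reduction {V ∘ π₁} record
      { Matrix  = _
      ; matrix  = Σ₁.matrix V-Σ₁ ∘ᴾ (var 0F ∷ᴿ π₁ᴿ (var 1F) ∷ᴿ var 2F ∷ᴿ []ᴿ)
      ; Σ₁-spec = λ { (z ∷ x ∷ []) → Σ₁.Σ₁-spec V-Σ₁ (π₁ z ∷ x ∷ []) }
      })
      where
      padded : ∃[ h ] Recursive₁ h × Injective _≡_ _≡_ h × (∀ m → V (π₁ m) ≐ ν (h m)) → V ≼ ν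
      padded (h , hᴿ , h-injective , h-correct) = record
        { reduce       = λ x → h ⟨ x , pad (x ∷ []) ⟩
        ; reduceᴿ      = cast (λ { (x ∷ []) → refl }) (app₁ hᴿ ⟨ var 0F , proj₁ (proj₂ padding) ⟩ᴿ)
        ; injective    = proj₁ ∘ ⟨,⟩-injective ∘ h-injective
        ; inflationary = λ x → proj₂ (proj₂ padding) (x ∷ [])
        ; correct      = λ x → subst (λ i → V i ≐ ν (h ⟨ x , pad (x ∷ []) ⟩))
                                     (π₁-⟨⟩ x (pad (x ∷ []))) (h-correct _)
        }
        where
        padding : ∃[ pad ] Recursive {1} pad × ∀ xs → lookup xs 0F < h ⟨ lookup xs 0F , pad xs ⟩
        padding = minimise (var 1F <ᴾ app₁ hᴿ ⟨ var 1F , var 0F ⟩ᴿ)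
          (λ { (x ∷ []) → unbounded (proj₂ ∘ ⟨,⟩-injective ∘ h-injective) x })

        pad : Vec ℕ 1 → ℕ
        pad = proj₁ padding

-- Partial functions given by approximations

first : (ℕ → ℕ) → ℕ → ℕ
first e = primrec 0 (λ u r → ifz r (e u) r)

first-sound : ∀ e w {y} → first e w ≡ suc y → ∃[ u ] e u ≡ suc y
first-sound e (suc w) eq with first e w in eq′
... | zero  = w , eq
... | suc _ = first-sound e w (trans eq′ eq)

first-persists : ∀ e {w w′ y} → w ≤ w′ → first e w ≡ suc y → first e w′ ≡ suc y
first-persists e {w′ = zero}       z≤n    eq = eq
first-persists e {w} {w′ = suc w′} w≤1+w′ eq with w ≟ suc w′
... | yes refl = eq
... | no  w≢   rewrite first-persists e (≤-pred (≤∧≢⇒< w≤1+w′ w≢)) eq = refl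

first-unique : ∀ e w w′ {y y′} → first e w ≡ suc y → first e w′ ≡ suc y′ → y ≡ y′
first-unique e w w′ eq eq′ with ≤-total w w′
... | inj₁ w≤w′ = suc-injective (trans (sym (first-persists e w≤w′ eq)) eq′)
... | inj₂ w′≤w = suc-injective (trans (sym eq) (first-persists e w′≤w eq′))

first-complete : ∀ e u {y} → e u ≡ suc y → ∃[ y′ ] first e (suc u) ≡ suc y′
first-complete e u eq with first e u
... | zero  = _ , eq
... | suc _ = _ , refl

-- The value at n is v if suc v is the first nonzero number in the sequence e n.

Listed : (ℕ → ℕ → ℕ) → Partial 1
Listed e = record
  { Graph      = λ xs y → ∃[ w ] first (e (head xs)) w ≡ suc y
  ; functional = λ {xs} (w , eq) (w′ , eq′) → first-unique (e (head xs)) w w′ eq eq′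
  }

Recursive₃ : (ℕ → ℕ → ℕ → ℕ) → Set
Recursive₃ f = Recursive {3} (f $ⁿ_)

firstᴿ : ∀ {e : Vec ℕ n → ℕ → ℕ} {f : Vec ℕ n → ℕ} →
         Recursive (λ xs → e (tail xs) (head xs)) → Recursive f →
         Recursive (λ xs → first (e xs) (f xs))
firstᴿ R S = primrecᴿ zeroᴿ
  (ifzᴿ (var 1F) (R ∘ᴿ (var 0F ∷ᴿ tailᴿ (tailᴿ idᴿ))) (var 1F)) S

-- Quasi-Gödel numberings

module QuasiGödelNumbering (P : Pairing) {A : Pred ℕ 0ℓ} {θ : ℕ → Partial 1}
                           (quasi : IsQuasiGödelNumbering P A θ) where
  open Unpairing P
  open IsQuasiGödelNumbering quasi
  open IsNumberingOf isNumbering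

  range-Σ₁ : UniformlyΣ₁ (λ i → Range (θ i))
  range-Σ₁ = enumerated QGN-I
    where
    enumerated : ∃[ h ] Computable 1 h × ExtGraph₂ P (universal θ) ≐ Range (total 1 h) →
                 UniformlyΣ₁ (λ i → Range (θ i))
    enumerated (h , h-computable , sub , sup) = record
      { Matrix  = _
      -- An entry ⟨ ⟨ i , x ⟩ , suc y ⟩ is recognised with x left free; the successor excludes the
      -- dummy elements of the extended graph.
      ; matrix  = π₁ᴿ (π₁ᴿ (hᴿ (var {3} 0F))) ≡ᴾ var 1F ×ᴾ π₂ᴿ (hᴿ (var 0F)) ≡ᴾ sucᴿ (var 2F)
      ; Σ₁-spec = λ { (i ∷ y ∷ []) → mk⇔ (fwd i y) (bwd i y) }
      }
      where
      hᴿ : ∀ {f : Vec ℕ n → ℕ} → Recursive f → Recursive (h ∘ f)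
      hᴿ = app₁ (fromComputable h-computable)

      fwd : ∀ i y → y ∈ Range (θ i) → ∃[ t ] π₁ (π₁ (h t)) ≡ i × π₂ (h t) ≡ suc y
      fwd i y (x ∷ [] , gr) with t ∷ [] , eq ← sub (inj₂ (i , x , y , gr , refl)) =
        t , trans (cong (π₁ ∘ π₁) eq) (trans (cong π₁ (π₁-⟨⟩ _ _)) (π₁-⟨⟩ _ _)) ,
        trans (cong π₂ eq) (π₂-⟨⟩ _ _)

      bwd : ∀ i y → ∃[ t ] π₁ (π₁ (h t)) ≡ i × π₂ (h t) ≡ suc y → y ∈ Range (θ i)
      bwd i y (t , eq₁ , eq₂) with sup (t ∷ [] , refl)
      ... | inj₁ (_ , _ , eq) =
        contradiction (trans (sym eq₂) (trans (cong π₂ eq) (π₂-⟨⟩ _ _))) 1+n≢0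
      ... | inj₂ (i′ , x , y′ , gr , eq)
        with refl ← trans (sym eq₁) (trans (cong (π₁ ∘ π₁) eq)
                      (trans (cong π₁ (π₁-⟨⟩ _ _)) (π₁-⟨⟩ _ _)))
           | refl ← trans (sym eq₂) (trans (cong π₂ eq) (π₂-⟨⟩ _ _)) = x ∷ [] , gr

  -- The values of `first` already have the format of the extended graph: 0 gives a dummy element
  -- and suc y an entry. Bound 0 supplies every dummy element.
  listed-index : ∀ {e} → Recursive₃ e →
    ∃[ v ] Recursive₁ v × (∀ i → Listed (e i) ∈ 𝓢 A → Listed (e i) ≈ θ (v i))
  listed-index {e} eᴿ =
    let v , v-computable , v-spec = QGN-II k (toComputable kᴿ)
    in v , fromComputable v-computable , λ i ∈𝓢 → v-spec i (Listed (e i)) ∈𝓢 (sub i , sup i)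
    where
    k : ℕ → ℕ → ℕ
    k i t = ⟨ π₁ t , first (e i (π₁ t)) (π₂ t) ⟩

    kᴿ : Recursive {2} (k $ⁿ_)
    kᴿ = cast (λ { (i ∷ t ∷ []) → refl })
      ⟨ π₁ᴿ (var {2} 1F)
      , firstᴿ {e = λ xs → e (lookup xs 0F) (π₁ (lookup xs 1F))} {f = λ xs → π₂ (lookup xs 1F)}
          (cast (λ { (u ∷ i ∷ t ∷ []) → refl })
            (eᴿ ∘ᴿ (var {3} 1F ∷ᴿ π₁ᴿ (var 2F) ∷ᴿ var 0F ∷ᴿ []ᴿ)))
          (π₂ᴿ (var 1F)) ⟩ᴿ

    k-⟨⟩ : ∀ i x w → k i ⟨ x , w ⟩ ≡ ⟨ x , first (e i x) w ⟩
    k-⟨⟩ i x w = cong₂ (λ a b → ⟨ a , first (e i a) b ⟩) (π₁-⟨⟩ x w) (π₂-⟨⟩ x w)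

    sub : ∀ i {z} → z ∈ Range (total 1 (k i)) → z ∈ ExtGraph₁ P (Listed (e i))
    sub i (t ∷ [] , refl) with first (e i (π₁ t)) (π₂ t) in eq
    ... | zero  = inj₁ (_ , refl)
    ... | suc y = inj₂ (_ , y , (π₂ t , eq) , refl)

    sup : ∀ i {z} → z ∈ ExtGraph₁ P (Listed (e i)) → z ∈ Range (total 1 (k i))
    sup i (inj₁ (x , refl)) = ⟨ x , 0 ⟩ ∷ [] , k-⟨⟩ i x 0
    sup i (inj₂ (x , y , (w , eq) , refl)) = ⟨ x , w ⟩ ∷ [] , trans (k-⟨⟩ i x w) (cong ⟨ x ,_⟩ eq)

  module _ (A-ce : CE A) (A-infinite : Inf A) where

    A-code : Code 1
    A-code = proj₁ (proj₁ (proj₂ A-ce))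

    A⇔halts : ∀ a → a ∈ A ⇔ (∃[ y ] A-code [ a ∷ [] ]⇓ y)
    A⇔halts a = let _ , (c , eq) , sub , sup = A-ce in mk⇔
      (λ a∈A → map₂ (to (eq _ _)) (sub a∈A))
      (λ h → sup (map₂ (from (eq _ _)) h))

    -- A quasi-Gödel numbering decides Σ₁ questions: let r be constant on its domain, which is ω
    -- if D never holds, and otherwise is cut off at some a ∈ A beyond a number satisfying D.
    -- An index of r, together with the case in which θ places it, bounds the search for D.

    markov : ∀ {D : Vec ℕ 1 → Set} → RecPred D → ¬ ¬ (∃[ t ] D (t ∷ [])) → ∃[ t ] D (t ∷ [])
    markov {D} R ¬¬∃D = search-below (into (v 0))
      where
      open Σ₁ (halting-Σ₁ A-code) using (Matrix; matrix; Σ₁-spec)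

      -- w encodes a candidate a together with a stage at which a is found in A, and t.
      Cut : ℕ → Set
      Cut w = D (π₂ (π₂ w) ∷ []) × Matrix (π₁ (π₂ w) ∷ π₁ w ∷ []) × π₂ (π₂ w) < π₁ w

      cutᴾ : RecPred {1} (λ xs → Cut (lookup xs 0F))
      cutᴾ = R ∘ᴾ (π₂ᴿ (π₂ᴿ (var 0F)) ∷ᴿ []ᴿ) ×ᴾ
             matrix ∘ᴾ (π₁ᴿ (π₂ᴿ (var 0F)) ∷ᴿ π₁ᴿ (var 0F) ∷ᴿ []ᴿ) ×ᴾ
             π₂ᴿ (π₂ᴿ (var 0F)) <ᴾ π₁ᴿ (var 0F)

      -- The default 0 is unambiguous because a cut exceeds some t and so is positive; `first cut`
      -- freezes the first cut found.
      cut : ℕ → ℕ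
      cut w = ifz (char cutᴾ (w ∷ [])) (π₁ w) 0

      cutᴿ : ∀ {f : Vec ℕ n → ℕ} → Recursive f → Recursive (cut ∘ f)
      cutᴿ S = ifzᴿ (recursive cutᴾ ∘ᴿ (S ∷ᴿ []ᴿ)) (π₁ᴿ S) zeroᴿ

      -- The clauses do not conflict: an n with no t up to it in D lies below every cut, since cuts
      -- exceed an element of D.
      Included : ℕ → ℕ → Set
      Included n u = ¬ (∃[ t ] t < suc n × D (t ∷ [])) ⊎ n < first cut u

      includedᴾ : RecPred {2} (λ xs → Included (lookup xs 0F) (lookup xs 1F))
      includedᴾ = ¬ᴾ ∃<ᴾ (sucᴿ (var 0F)) (R ∘ᴾ (var 0F ∷ᴿ []ᴿ)) ⊎ᴾ
                  var 0F <ᴾ firstᴿ {e = λ _ → cut}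
                              (cast (λ { (_ ∷ _) → refl }) (cutᴿ (var 0F))) (var 1F)

      e : ℕ → ℕ → ℕ → ℕ
      e _ n u = ifz (char includedᴾ (n ∷ u ∷ [])) 1 0

      eᴿ : Recursive₃ e
      eᴿ = cast (λ { (_ ∷ n ∷ u ∷ []) → refl })
        (ifzᴿ (recursive includedᴾ ∘ᴿ (var {3} 1F ∷ᴿ var 2F ∷ᴿ []ᴿ)) (constᴿ 1) zeroᴿ)

      indexed = listed-index eᴿ

      v : ℕ → ℕ
      v = proj₁ indexed

      r : Partial 1
      r = Listed (e 0)

      dom-r : ∀ {n} → n ∈ Dom r ⇔ (∃[ u ] Included n u)
      dom-r {n} = mk⇔
        (λ (y , w , eq) → let u , eq′ = first-sound (e 0 n) w eq
                          in u , proj₁ (ifz-yes⁻¹ includedᴾ (n ∷ u ∷ []) eq′))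
        (λ (u , inc) → let y , eq = first-complete (e 0 n) u (ifz-yes includedᴾ (n ∷ u ∷ []) inc)
                       in y , suc u , eq)

      record CutOff : Set where
        field
          t a   : ℕ
          Dt    : D (t ∷ [])
          a∈A   : a ∈ A
          t<a   : t < a
          dom≐a : Dom r ≐ (_< a)

      cut-off : ∃[ w ] Cut w → CutOff
      cut-off (w , c@(_ , _ , t<a))
        -- The domain is determined by the first cut found, not by that of w; u is where it was
        -- found, with a t and an a of its own.
        with b , found ← first-complete cut w
               (trans (ifz-yes cutᴾ (w ∷ []) c) (sym (suc-pred-≢0 (m<n⇒n≢0 t<a))))
        with u , eq ← first-sound cut (suc w) found
        with (Dt , found-in-A , t<a) , a≡ ← ifz-yes⁻¹ cutᴾ (u ∷ []) eq
        = record
          { Dt    = Dt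
          ; a∈A   = from (A⇔halts _) (from (Σ₁-spec _) (_ , found-in-A))
          ; t<a   = t<a
          ; dom≐a = (λ {n} n∈ → let u′ , inc = to dom-r n∈ in below n u′ inc)
                  , λ {n} n<a → from dom-r (suc w , inj₂ (subst (n <_) (trans a≡ (sym found)) n<a))
          }
        where
        below : ∀ n u′ → Included n u′ → n < π₁ u
        below n _  (inj₁ none) = ≤-trans (≰⇒> (λ t≤n → none (_ , s≤s t≤n , Dt))) (<⇒≤ t<a)
        below n u′ (inj₂ n<first) with first cut u′ in eq′
        ... | suc _ = subst (n <_)
          (trans (cong suc (first-unique cut u′ (suc w) eq′ found)) (sym a≡)) n<first

      -- `Inf` only refutes a bound on A, so an element of A beyond t is available only up to double
      -- negation.
      ¬¬cut-off : ¬ ¬ CutOff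
      ¬¬cut-off ¬cut-off = ¬¬∃D λ (t , Dt) → A-infinite (suc t , λ a t<a a∈A →
        let s , found = to (Σ₁-spec (a ∷ [])) (to (A⇔halts a) a∈A)
            w = ⟨ a , ⟨ s , t ⟩ ⟩
            eq₁ = π₁-⟨⟩ a ⟨ s , t ⟩
            eq₂ = trans (cong π₁ (π₂-⟨⟩ a ⟨ s , t ⟩)) (π₁-⟨⟩ s t)
            eq₃ = trans (cong π₂ (π₂-⟨⟩ a ⟨ s , t ⟩)) (π₂-⟨⟩ s t)
        in ¬cut-off (cut-off (w
             , subst (λ t → D (t ∷ [])) (sym eq₃) Dt
             , subst Matrix (sym (cong₂ (λ s a → s ∷ a ∷ []) eq₂ eq₁)) found
             , subst (_< π₁ w) (sym eq₃) (subst (t <_) (sym eq₁) t<a))))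

      dom-θ : (C : CutOff) → Dom (θ (v 0)) ≐ (_< CutOff.a C)
      dom-θ C =
        (λ (y , gr) → proj₁ dom≐a (y , from (r≈θ _ y) gr)) ,
        (λ n<a → let y , gr = proj₂ dom≐a n<a in y , to (r≈θ _ y) gr)
        where
        open CutOff C
        r≈θ : r ≈ θ (v 0)
        r≈θ = proj₂ (proj₂ indexed) 0 (inj₂ (inj₂ (a , a∈A , dom≐a)))

      search-below : θ (v 0) ∈ 𝓢 A → ∃[ t ] D (t ∷ [])
      search-below (inj₁ (_ , θ-total)) = contradiction
        (λ C → <-irrefl refl (proj₁ (dom-θ C) (θ-total (CutOff.a C ∷ [])))) ¬¬cut-off
      search-below (inj₂ (inj₁ empty)) = contradiction
        (λ C → empty 0 (proj₂ (dom-θ C) (≤-trans z<s (CutOff.t<a C)))) ¬¬cut-off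
      -- Up to double negation some t in D lies in the domain of θ (v 0), hence below b; this
      -- bounded search is decidable.
      search-below (inj₂ (inj₂ (b , _ , dom≐b))) =
        let t , _ , Dt = decidable-stable (anyUpTo? (λ t → holds? R (t ∷ [])) b)
              (λ none → ¬¬cut-off λ C → let open CutOff C in
                none (t , proj₁ dom≐b (proj₂ (dom-θ C) t<a) , Dt))
        in t , Dt

    -- The two inclusions differ: an element of V i shows that the listed function is total, whereas
    -- an element of the range gives only a doubly negated Σ₁ statement, to which `markov` applies.
    range-reduction : ∀ {V : ℕ → Pred ℕ 0ℓ} → UniformlyΣ₁ V →
      ∃[ v ] Recursive₁ v × (∀ i → V i ≐ Range (θ (v i)))
    range-reduction {V} V-Σ₁ = v , proj₁ (proj₂ indexed) , λ i → sub i , sup i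
      where
      open Σ₁ V-Σ₁

      found : ℕ → ℕ → ℕ
      found i u = ifz (char matrix (π₂ u ∷ i ∷ π₁ u ∷ [])) (suc (π₁ u)) 0

      foundᴿ : ∀ {f g : Vec ℕ n → ℕ} → Recursive f → Recursive g →
               Recursive (λ xs → found (f xs) (g xs))
      foundᴿ S T =
        ifzᴿ (recursive matrix ∘ᴿ (π₂ᴿ T ∷ᴿ S ∷ᴿ π₁ᴿ T ∷ᴿ []ᴿ)) (sucᴿ (π₁ᴿ T)) zeroᴿ

      -- The value at n is the element found at n, or, failing that, the first one found at all.
      e : ℕ → ℕ → ℕ → ℕ
      e i n u = ifz u (found i n) (found i (pred u))

      eᴿ : Recursive₃ e
      eᴿ = cast (λ { (i ∷ n ∷ u ∷ []) → refl })
        (ifzᴿ (var {3} 2F) (foundᴿ (var 0F) (var 1F)) (foundᴿ (var 0F) (predᴿ (var 2F))))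

      indexed = listed-index eᴿ

      v : ℕ → ℕ
      v = proj₁ indexed

      found-sound : ∀ {i u y} → found i u ≡ suc y → y ∈ V i
      found-sound {i} {u} eq with M , refl ← ifz-yes⁻¹ matrix (π₂ u ∷ i ∷ π₁ u ∷ []) eq =
        from (Σ₁-spec (i ∷ _ ∷ [])) (_ , M)

      found-complete : ∀ {i y} → y ∈ V i → ∃[ u ] found i u ≡ suc y
      found-complete {i} {y} y∈V =
        let t , M = to (Σ₁-spec (i ∷ y ∷ [])) y∈V
            eq₁ = π₁-⟨⟩ y t ; eq₂ = π₂-⟨⟩ y t
        in ⟨ y , t ⟩ , trans (ifz-yes matrix _
             (subst Matrix (sym (cong₂ (λ t y → t ∷ i ∷ y ∷ []) eq₂ eq₁)) M)) (cong suc eq₁)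

      e-sound : ∀ {i n u y} → e i n u ≡ suc y → y ∈ V i
      e-sound {i} {n} {zero}  = found-sound {u = n}
      e-sound {i} {n} {suc u} = found-sound {u = u}

      listed-total : ∀ {i y} → y ∈ V i → Listed (e i) ∈ 𝓡 1
      listed-total {i} y∈V = computed (minimise nonzeroᴾ nonzero)
        where
        valueᴿ : Recursive {2} (λ xs → first (e i (lookup xs 1F)) (lookup xs 0F))
        valueᴿ = firstᴿ {e = λ xs → e i (lookup xs 1F)}
          (cast (λ { (u ∷ w ∷ n ∷ []) → refl })
            (eᴿ ∘ᴿ (constᴿ {3} i ∷ᴿ var 2F ∷ᴿ var 0F ∷ᴿ []ᴿ))) (var 0F)

        nonzeroᴾ : RecPred {2} (λ xs → first (e i (lookup xs 1F)) (lookup xs 0F) ≢ 0)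
        nonzeroᴾ = ¬ᴾ (valueᴿ ≡ᴾ zeroᴿ)

        nonzero : ∀ xs → ∃[ w ] first (e i (lookup xs 0F)) w ≢ 0
        nonzero (n ∷ []) =
          let u , eq = found-complete y∈V
              y′ , eq′ = first-complete (e i n) (suc u) eq
          -- Stage 0 tries n itself, so the element found at u is tried at stage suc u, and `first`
          -- needs a bound above that.
          in suc (suc u) , λ ≡0 → 1+n≢0 (trans (sym eq′) ≡0)

        computed : ∃[ μ ] Recursive {1} μ × (∀ xs → first (e i (lookup xs 0F)) (μ xs) ≢ 0) →
                   Listed (e i) ∈ 𝓡 1
        computed (μ , μᴿ , μ-spec) =
          (code value , λ { xs@(_ ∷ []) y → mk⇔
            (λ gr → subst (code value [ xs ]⇓_)
                      (functional (Listed (e i)) {xs} (value-listed xs) gr) (computes value xs))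
            (λ c⇓ → subst (Graph (Listed (e i)) xs) (⇓-functional (computes value xs) c⇓)
                      (value-listed xs)) })
          , λ xs → _ , value-listed xs
          where
          value : Recursive {1} (λ xs → pred (first (e i (lookup xs 0F)) (μ xs)))
          value = predᴿ (valueᴿ ∘ᴿ (μᴿ ∷ᴿ var 0F ∷ᴿ []ᴿ))

          value-listed : ∀ xs → Graph (Listed (e i)) xs (pred (first (e i (lookup xs 0F)) (μ xs)))
          value-listed xs@(_ ∷ []) = μ xs , sym (suc-pred-≢0 (μ-spec xs))

      ¬¬listed∈𝓢 : ∀ i → ¬ ¬ (Listed (e i) ∈ 𝓢 A)
      ¬¬listed∈𝓢 i ¬∈ = ¬∈ (inj₂ (inj₁ λ n (y , w , eq) →
        let u , eq′ = first-sound (e i n) w eq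
        in ¬∈ (inj₁ (listed-total (e-sound {i} {n} {u} eq′)))))

      sub : ∀ i {y} → y ∈ V i → y ∈ Range (θ (v i))
      sub i y∈V = let u , eq = found-complete y∈V in
        -- At argument u the element y is listed at stage 0, hence the bound 1.
        u ∷ [] , to (proj₂ (proj₂ indexed) i (inj₁ (listed-total y∈V)) _ _) (1 , eq)

      sup : ∀ i {y} → y ∈ Range (θ (v i)) → y ∈ V i
      sup i {y} (n ∷ [] , gr) = from (Σ₁-spec _)
        (markov (matrix ∘ᴾ (var 0F ∷ᴿ constᴿ i ∷ᴿ constᴿ y ∷ᴿ []ᴿ)) λ none →
          ¬¬listed∈𝓢 i λ ∈𝓢 →
            let w , eq  = from (proj₂ (proj₂ indexed) i ∈𝓢 (n ∷ []) y) gr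
                u , eq′ = first-sound (e i n) w eq
            in none (to (Σ₁-spec _) (e-sound {i} {n} {u} eq′)))

theorem5p21 : (P : Pairing) (A : Pred ℕ 0ℓ) → CE A → Inf A →
    (θ : ℕ → Partial 1) → IsQuasiGödelNumbering P A θ →
    (φ : ℕ → Partial 1) → IsGödelNumbering φ →
    ComputablyIsomorphic (λ i → Range (θ i)) (λ i → Dom (φ i))
theorem5p21 P A A-ce A-infinite θ quasi φ gödel =
  SchröderBernstein.isomorphic
    -- W reduces to itself by the identity, so the target may be W.
    (reduction {r = id} (cast (λ { (_ ∷ []) → refl }) (var 0F)) (λ _ → id , id) range-Σ₁)
    (let v , vᴿ , v-correct = range-reduction A-ce A-infinite dom-Σ₁
     in reduction vᴿ v-correct dom-Σ₁)
  where
  open GödelNumbering P gödel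
  open QuasiGödelNumbering P quasi
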